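{- For every regular command $\mathsf{r}$ and all $P,Q\subseteq\Sigma$, the SIL triple $\langle P\rangle\,\mathsf{r}\,\langle Q\rangle$ is derivable in the SIL proof system if and only if it is valid, i.e. if and only if $\overleftarrow{[\![\mathsf{r}]\!]}Q\supseteq P$.
   Context: $\mathrm{Var}$ is a finite set of variables and $\Sigma=\mathrm{Var}\to\mathbb{Z}$ is the set of states. Regular commands: atomic commands $\mathsf{c}::=\mathtt{skip}\mid x:=a\mid b?$ (integer arithmetic expression $a$, Boolean expression $b$, evaluated as usual) and $\mathsf{r}::=\mathsf{c}\mid \mathsf{r};\mathsf{r}\mid\mathsf{r}\boxplus\mathsf{r}\mid\mathsf{r}^*$. For $S\subseteq\Sigma$: $[\![\mathtt{skip}]\!]S=S$, $[\![x:=a]\!]S=\{\sigma[x\mapsto[\![a]\!]\sigma]\mid\sigma\in S\}$, $[\![b?]\!]S=\{\sigma\in S\mid[\![b]\!]\sigma=\mathrm{true}\}$. Forward collecting semantics: $\overrightarrow{[\![\mathsf{c}]\!]}S=[\![\mathsf{c}]\!]S$, $\overrightarrow{[\![\mathsf{r}_1;\mathsf{r}_2]\!]}S=\overrightarrow{[\![\mathsf{r}_2]\!]}(\overrightarrow{[\![\mathsf{r}_1]\!]}S)$, $\overrightarrow{[\![\mathsf{r}_1\boxplus\mathsf{r}_2]\!]}S=\overrightarrow{[\![\mathsf{r}_1]\!]}S\cup\overrightarrow{[\![\mathsf{r}_2]\!]}S$, $\overrightarrow{[\![\mathsf{r}^*]\!]}S=\bigcup_{n\ge0}\overrightarrow{[\![\mathsf{r}]\!]}^nS$.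 Backward semantics: $\overleftarrow{[\![\mathsf{r}]\!]}\sigma'=\{\sigma\mid\sigma'\in\overrightarrow{[\![\mathsf{r}]\!]}\{\sigma\}\}$, lifted to sets by union. The SIL proof system derives triples $\langle P\rangle\,\mathsf{r}\,\langle Q\rangle$ ($P,Q\subseteq\Sigma$) with exactly the following rules: (atom) $\langle\overleftarrow{[\![\mathsf{c}]\!]}Q\rangle\,\mathsf{c}\,\langle Q\rangle$ for every atomic $\mathsf{c}$ and $Q$; (cons) from $P\subseteq P'$, $\langle P'\rangle\,\mathsf{r}\,\langle Q'\rangle$, $Q'\subseteq Q$ derive $\langle P\rangle\,\mathsf{r}\,\langle Q\rangle$; (seq) from $\langle P\rangle\,\mathsf{r}_1\,\langle R\rangle$ and $\langle R\rangle\,\mathsf{r}_2\,\langle Q\rangle$ derive $\langle P\rangle\,\mathsf{r}_1;\mathsf{r}_2\,\langle Q\rangle$; (choice) from $\langle P_1\rangle\,\mathsf{r}_1\,\langle Q\rangle$ and $\langle P_2\rangle\,\mathsf{r}_2\,\langle Q\rangle$ derive $\langle P_1\cup P_2\rangle\,\mathsf{r}_1\boxplus\mathsf{r}_2\,\langle Q\rangle$; (iter) from $\langle Q_{n+1}\rangle\,\mathsf{r}\,\langle Q_n\rangle$ for all $n\ge0$ (infinitely many premises) derive $\langle\bigcup_{n\ge0}Q_n\rangle\,\mathsf{r}^*\,\langle Q_0\rangle$. Derivations may be infinitely branching but are well-founded. -}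

module Defs where

open import Data.Bool using (Bool; true; false; not; _∧_; _∨_)
open import Data.Fin using (Fin)
open import Data.Integer as ℤ using (ℤ)
open import Data.Nat using (ℕ; zero; suc)
open import Data.Product using (∃-syntax; _×_)
open import Data.Vec using (Vec; lookup; _[_]≔_)
open import Level using (0ℓ)
open import Relation.Binary.PropositionalEquality using (_≡_)
open import Relation.Nullary.Decidable using (⌊_⌋)
open import Relation.Unary using (Pred; _∈_; _⊆_; _⊇_; _∪_; ⋃; ｛_｝)

infixl 7 _⊗_
infixl 6 _⊕_ _⊖_
infix  5 _≔_
infix  5 _==_ _≤_ _<_
infixr 4 _and_
infixr 3 _or_
infixl 5 _⋆
infixr 4 _⨾_
infixr 3 _⊞_

-- The finite set of variables is Fin n.  A state, a function Fin n → ℤ, is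
-- given by its table of values: on Vec ℤ n, _≡_ is pointwise equality, whereas
-- on Fin n → ℤ this would require function extensionality.

Var : ℕ → Set
Var n = Fin n

State : ℕ → Set
State n = Vec ℤ n

StateSet : ℕ → Set₁
StateSet n = Pred (State n) 0ℓ

data AExp (n : ℕ) : Set where
  lit         : ℤ → AExp n
  var         : Var n → AExp n
  _⊕_ _⊖_ _⊗_ : AExp n → AExp n → AExp n

data BExp (n : ℕ) : Set where
  tt ff        : BExp n
  _==_ _≤_ _<_ : AExp n → AExp n → BExp n
  neg          : BExp n → BExp n
  _and_ _or_   : BExp n → BExp n → BExp n

data Atom (n : ℕ) : Set where
  skip   : Atom n
  _≔_    : Var n → AExp n → Atom n
  assume : BExp n → Atom n          -- b?

data Reg (n : ℕ) : Set where
  atom : Atom n → Reg n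
  _⨾_  : Reg n → Reg n → Reg n
  _⊞_  : Reg n → Reg n → Reg n
  _⋆   : Reg n → Reg n

private
  variable
    n : ℕ

⟦_⟧ᵃ : AExp n → State n → ℤ
⟦ lit z ⟧ᵃ   σ = z
⟦ var x ⟧ᵃ   σ = lookup σ x
⟦ a₁ ⊕ a₂ ⟧ᵃ σ = ⟦ a₁ ⟧ᵃ σ ℤ.+ ⟦ a₂ ⟧ᵃ σ
⟦ a₁ ⊖ a₂ ⟧ᵃ σ = ⟦ a₁ ⟧ᵃ σ ℤ.- ⟦ a₂ ⟧ᵃ σ
⟦ a₁ ⊗ a₂ ⟧ᵃ σ = ⟦ a₁ ⟧ᵃ σ ℤ.* ⟦ a₂ ⟧ᵃ σ

⟦_⟧ᵇ : BExp n → State n → Bool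
⟦ tt ⟧ᵇ        σ = true
⟦ ff ⟧ᵇ        σ = false
⟦ a₁ == a₂ ⟧ᵇ  σ = ⌊ ⟦ a₁ ⟧ᵃ σ ℤ.≟ ⟦ a₂ ⟧ᵃ σ ⌋
⟦ a₁ ≤ a₂ ⟧ᵇ   σ = ⌊ ⟦ a₁ ⟧ᵃ σ ℤ.≤? ⟦ a₂ ⟧ᵃ σ ⌋
⟦ a₁ < a₂ ⟧ᵇ   σ = ⌊ ⟦ a₁ ⟧ᵃ σ ℤ.<? ⟦ a₂ ⟧ᵃ σ ⌋
⟦ neg b ⟧ᵇ     σ = not (⟦ b ⟧ᵇ σ)
⟦ b₁ and b₂ ⟧ᵇ σ = ⟦ b₁ ⟧ᵇ σ ∧ ⟦ b₂ ⟧ᵇ σ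
⟦ b₁ or b₂ ⟧ᵇ  σ = ⟦ b₁ ⟧ᵇ σ ∨ ⟦ b₂ ⟧ᵇ σ

⟦_⟧ᶜ : Atom n → StateSet n → StateSet n
⟦ skip ⟧ᶜ     S = S
⟦ x ≔ a ⟧ᶜ    S = λ σ′ → ∃[ σ ] σ ∈ S × σ′ ≡ σ [ x ]≔ ⟦ a ⟧ᵃ σ
⟦ assume b ⟧ᶜ S = λ σ → σ ∈ S × ⟦ b ⟧ᵇ σ ≡ true

iterate : {A : Set₁} → (A → A) → ℕ → A → A
iterate f zero    x = x
iterate f (suc k) x = f (iterate f k x)

fwd : Reg n → StateSet n → StateSet n
fwd (atom c)  S = ⟦ c ⟧ᶜ S
fwd (r₁ ⨾ r₂) S = fwd r₂ (fwd r₁ S)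
fwd (r₁ ⊞ r₂) S = fwd r₁ S ∪ fwd r₂ S
fwd (r ⋆)     S = ⋃ ℕ λ k → iterate (fwd r) k S

bwdState : Reg n → State n → StateSet n
bwdState r σ′ = λ σ → σ′ ∈ fwd r ｛ σ ｝

bwd : Reg n → StateSet n → StateSet n
bwd r Q = λ σ → ∃[ σ′ ] σ′ ∈ Q × σ ∈ bwdState r σ′

infix 2 ⊢⟨_⟩_⟨_⟩ ⊨⟨_⟩_⟨_⟩

-- Derivations are inductive, hence well-founded; the iter node branches over ℕ.
data ⊢⟨_⟩_⟨_⟩ {n : ℕ} : StateSet n → Reg n → StateSet n → Set₁ where
  atom   : ∀ c Q →
           ⊢⟨ bwd (atom c) Q ⟩ atom c ⟨ Q ⟩
  cons   : ∀ {P P′ Q Q′ r} →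
           P ⊆ P′ → ⊢⟨ P′ ⟩ r ⟨ Q′ ⟩ → Q′ ⊆ Q →
           ⊢⟨ P ⟩ r ⟨ Q ⟩
  seq    : ∀ {P R Q r₁ r₂} →
           ⊢⟨ P ⟩ r₁ ⟨ R ⟩ → ⊢⟨ R ⟩ r₂ ⟨ Q ⟩ →
           ⊢⟨ P ⟩ r₁ ⨾ r₂ ⟨ Q ⟩
  choice : ∀ {P₁ P₂ Q r₁ r₂} →
           ⊢⟨ P₁ ⟩ r₁ ⟨ Q ⟩ → ⊢⟨ P₂ ⟩ r₂ ⟨ Q ⟩ →
           ⊢⟨ P₁ ∪ P₂ ⟩ r₁ ⊞ r₂ ⟨ Q ⟩
  iter   : ∀ {r} (Q : ℕ → StateSet n) →
           (∀ k → ⊢⟨ Q (suc k) ⟩ r ⟨ Q k ⟩) →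
           ⊢⟨ ⋃ ℕ Q ⟩ r ⋆ ⟨ Q 0 ⟩

⊨⟨_⟩_⟨_⟩ : StateSet n → Reg n → StateSet n → Set
⊨⟨ P ⟩ r ⟨ Q ⟩ = bwd r Q ⊇ P

{-# OPTIONS --safe #-}

-- The forward semantics is additive: a state reachable from S is reachable from
-- a single state of S.  Hence the backward semantics is compositional: on a
-- sequence it composes in reverse order, and the r ⋆ preimage of Q is the union
-- of the iterated r preimages of Q.  Completeness then reduces to deriving
-- ⟨ bwd r Q ⟩ r ⟨ Q ⟩ by induction on r.
module Submission where

open import Defs
open import Data.Nat using (ℕ; zero; suc)
open import Data.Product using (∃-syntax; _×_; _,_)
open import Data.Sum as Sum using (inj₁; inj₂)
open import Function using (id)
open import Function.Bundles using (_⇔_; mk⇔)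
open import Relation.Binary.PropositionalEquality using (_≡_; refl; cong; subst; sym)
open import Relation.Unary using (_∈_; _⊆_; _∪_; ⋃; ｛_｝)

private
  variable
    n : ℕ

Transformer : ℕ → Set₁
Transformer n = StateSet n → StateSet n

Monotone : Transformer n → Set₁
Monotone {n} F = ∀ {S T : StateSet n} → S ⊆ T → F S ⊆ F T

-- Together with `Monotone` this is additivity: `F S` is the union of the sets `F ｛ σ ｝` over
-- `σ ∈ S`.
PointGenerated : Transformer n → Set₁
PointGenerated {n} F = ∀ (S : StateSet n) {τ} → τ ∈ F S → ∃[ σ ] σ ∈ S × τ ∈ F ｛ σ ｝

｛｝-⊆ : ∀ {S : StateSet n} {σ} → σ ∈ S → ｛ σ ｝ ⊆ S
｛｝-⊆ σ∈S refl = σ∈S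

iterate-suc : ∀ {A : Set₁} (f : A → A) k x → iterate f (suc k) x ≡ iterate f k (f x)
iterate-suc f zero    x = refl
iterate-suc f (suc k) x = cong f (iterate-suc f k x)

iterate-mono : {F : Transformer n} → Monotone F → ∀ k → Monotone (iterate F k)
iterate-mono mono zero    S⊆T = S⊆T
iterate-mono mono (suc k) S⊆T = mono (iterate-mono mono k S⊆T)

-- `G` singles out an intermediate state `ρ`, `F` then a source of `ρ`; monotonicity of `G` enlarges
-- `｛ ρ ｝` back to `F ｛ σ ｝`.
∘-pointGenerated : {F G : Transformer n} → Monotone G → PointGenerated F → PointGenerated G →
                   PointGenerated (λ S → G (F S))
∘-pointGenerated G-mono F-gen G-gen S τ∈GFS =
  let ρ , ρ∈FS , τ∈Gρ = G-gen _ τ∈GFS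
      σ , σ∈S  , ρ∈Fσ = F-gen S ρ∈FS
  in  σ , σ∈S , G-mono (｛｝-⊆ ρ∈Fσ) τ∈Gρ

iterate-pointGenerated : {F : Transformer n} → Monotone F → PointGenerated F →
                         ∀ k → PointGenerated (iterate F k)
iterate-pointGenerated mono gen zero    S τ∈S = _ , τ∈S , refl
iterate-pointGenerated mono gen (suc k) =
  ∘-pointGenerated mono (iterate-pointGenerated mono gen k) gen

⟦⟧ᶜ-mono : (c : Atom n) → Monotone ⟦ c ⟧ᶜ
⟦⟧ᶜ-mono skip       S⊆T σ∈S            = S⊆T σ∈S
⟦⟧ᶜ-mono (x ≔ a)    S⊆T (σ , σ∈S , eq) = σ , S⊆T σ∈S , eq
⟦⟧ᶜ-mono (assume b) S⊆T (σ∈S , b≡true) = S⊆T σ∈S , b≡true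

⟦⟧ᶜ-pointGenerated : (c : Atom n) → PointGenerated ⟦ c ⟧ᶜ
⟦⟧ᶜ-pointGenerated skip       S σ∈S            = _ , σ∈S , refl
⟦⟧ᶜ-pointGenerated (x ≔ a)    S (σ , σ∈S , eq) = σ , σ∈S , σ , refl , eq
⟦⟧ᶜ-pointGenerated (assume b) S (σ∈S , b≡true) = _ , σ∈S , refl , b≡true

fwd-mono : (r : Reg n) → Monotone (fwd r)
fwd-mono (atom c)  S⊆T           = ⟦⟧ᶜ-mono c S⊆T
fwd-mono (r₁ ⨾ r₂) S⊆T           = fwd-mono r₂ (fwd-mono r₁ S⊆T)
fwd-mono (r₁ ⊞ r₂) S⊆T           = Sum.map (fwd-mono r₁ S⊆T) (fwd-mono r₂ S⊆T)
fwd-mono (r ⋆)     S⊆T (k , τ∈k) = k , iterate-mono (fwd-mono r) k S⊆T τ∈k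

fwd-pointGenerated : (r : Reg n) → PointGenerated (fwd r)
fwd-pointGenerated (atom c)  = ⟦⟧ᶜ-pointGenerated c
fwd-pointGenerated (r₁ ⨾ r₂) =
  ∘-pointGenerated (fwd-mono r₂) (fwd-pointGenerated r₁) (fwd-pointGenerated r₂)
fwd-pointGenerated (r₁ ⊞ r₂) S (inj₁ τ∈₁) =
  let σ , σ∈S , τ∈σ = fwd-pointGenerated r₁ S τ∈₁ in σ , σ∈S , inj₁ τ∈σ
fwd-pointGenerated (r₁ ⊞ r₂) S (inj₂ τ∈₂) =
  let σ , σ∈S , τ∈σ = fwd-pointGenerated r₂ S τ∈₂ in σ , σ∈S , inj₂ τ∈σ
fwd-pointGenerated (r ⋆) S (k , τ∈k) =
  let σ , σ∈S , τ∈σ = iterate-pointGenerated (fwd-mono r) (fwd-pointGenerated r) k S τ∈k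
  in  σ , σ∈S , k , τ∈σ

bwd-mono : (r : Reg n) → Monotone (bwd r)
bwd-mono r S⊆T (τ , τ∈S , τ∈σ) = τ , S⊆T τ∈S , τ∈σ

-- Monotonicity is enough here: the intermediate state is given, and its singleton lies in
-- `fwd r₁ ｛ σ ｝`.
bwd-⨾⁺ : ∀ (r₁ r₂ : Reg n) {Q} → bwd r₁ (bwd r₂ Q) ⊆ bwd (r₁ ⨾ r₂) Q
bwd-⨾⁺ r₁ r₂ (ρ , (τ , τ∈Q , τ∈ρ) , ρ∈σ) = τ , τ∈Q , fwd-mono r₂ (｛｝-⊆ ρ∈σ) τ∈ρ

-- Additivity of `fwd r₂` supplies the intermediate state.
bwd-⨾⁻ : ∀ (r₁ r₂ : Reg n) {Q} → bwd (r₁ ⨾ r₂) Q ⊆ bwd r₁ (bwd r₂ Q)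
bwd-⨾⁻ r₁ r₂ (τ , τ∈Q , τ∈σ) =
  let ρ , ρ∈σ , τ∈ρ = fwd-pointGenerated r₂ _ τ∈σ in ρ , (τ , τ∈Q , τ∈ρ) , ρ∈σ

bwd-⊞⁺ : ∀ (r₁ r₂ : Reg n) {Q} → bwd r₁ Q ∪ bwd r₂ Q ⊆ bwd (r₁ ⊞ r₂) Q
bwd-⊞⁺ r₁ r₂ (inj₁ (τ , τ∈Q , τ∈σ)) = τ , τ∈Q , inj₁ τ∈σ
bwd-⊞⁺ r₁ r₂ (inj₂ (τ , τ∈Q , τ∈σ)) = τ , τ∈Q , inj₂ τ∈σ

bwd-⊞⁻ : ∀ (r₁ r₂ : Reg n) {Q} → bwd (r₁ ⊞ r₂) Q ⊆ bwd r₁ Q ∪ bwd r₂ Q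
bwd-⊞⁻ r₁ r₂ (τ , τ∈Q , inj₁ τ∈σ) = inj₁ (τ , τ∈Q , τ∈σ)
bwd-⊞⁻ r₁ r₂ (τ , τ∈Q , inj₂ τ∈σ) = inj₂ (τ , τ∈Q , τ∈σ)

-- iterate puts the last step of a run outermost for fwd, but its first step
-- outermost for bwd; iterate-suc brings the first step of the fwd run inside.
iterate-bwd⁺ : ∀ (r : Reg n) {Q} k {σ} → σ ∈ iterate (bwd r) k Q →
               ∃[ τ ] τ ∈ Q × τ ∈ iterate (fwd r) k ｛ σ ｝
iterate-bwd⁺ r zero    σ∈Q = _ , σ∈Q , refl
iterate-bwd⁺ r (suc k) {σ} (ρ , ρ∈k , ρ∈σ) =
  let τ , τ∈Q , τ∈ρ = iterate-bwd⁺ r k ρ∈k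
  in  τ , τ∈Q , subst (τ ∈_) (sym (iterate-suc (fwd r) k ｛ σ ｝))
                  (iterate-mono (fwd-mono r) k (｛｝-⊆ ρ∈σ) τ∈ρ)

iterate-bwd⁻ : ∀ (r : Reg n) {Q} k {σ τ} → τ ∈ Q → τ ∈ iterate (fwd r) k ｛ σ ｝ →
               σ ∈ iterate (bwd r) k Q
iterate-bwd⁻ r zero    τ∈Q refl = τ∈Q
iterate-bwd⁻ r (suc k) {σ} {τ} τ∈Q τ∈σ =
  -- The last `k` steps start from the set `fwd r ｛ σ ｝`; additivity picks from it the state `ρ`
  -- reached after the first step.
  let ρ , ρ∈σ , τ∈ρ = iterate-pointGenerated (fwd-mono r) (fwd-pointGenerated r) k _
                        (subst (τ ∈_) (iterate-suc (fwd r) k ｛ σ ｝) τ∈σ)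
  in  ρ , iterate-bwd⁻ r k τ∈Q τ∈ρ , ρ∈σ

bwd-⋆⁺ : ∀ (r : Reg n) {Q} → ⋃ ℕ (λ k → iterate (bwd r) k Q) ⊆ bwd (r ⋆) Q
bwd-⋆⁺ r (k , σ∈k) = let τ , τ∈Q , τ∈σ = iterate-bwd⁺ r k σ∈k in τ , τ∈Q , k , τ∈σ

bwd-⋆⁻ : ∀ (r : Reg n) {Q} → bwd (r ⋆) Q ⊆ ⋃ ℕ (λ k → iterate (bwd r) k Q)
bwd-⋆⁻ r (τ , τ∈Q , k , τ∈σ) = k , iterate-bwd⁻ r k τ∈Q τ∈σ

-- The iterates of `bwd r` form the largest sequence with first member `Q 0` that satisfies the
-- semantic premises of `iter`.
⊆-iterate-bwd : ∀ (r : Reg n) (Q : ℕ → StateSet n) → (∀ k → Q (suc k) ⊆ bwd r (Q k)) →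
                ∀ k → Q k ⊆ iterate (bwd r) k (Q 0)
⊆-iterate-bwd r Q step zero    σ∈Q = σ∈Q
⊆-iterate-bwd r Q step (suc k) σ∈Q = bwd-mono r (⊆-iterate-bwd r Q step k) (step k σ∈Q)

sound : ∀ {r : Reg n} {P Q} → ⊢⟨ P ⟩ r ⟨ Q ⟩ → ⊨⟨ P ⟩ r ⟨ Q ⟩
sound (atom c Q) σ∈P = σ∈P
sound {r = r} (cons P⊆P′ d Q′⊆Q) σ∈P = bwd-mono r Q′⊆Q (sound d (P⊆P′ σ∈P))
sound {r = r₁ ⨾ r₂} (seq d₁ d₂) σ∈P =
  bwd-⨾⁺ r₁ r₂ (bwd-mono r₁ (sound d₂) (sound d₁ σ∈P))
sound {r = r₁ ⊞ r₂} (choice d₁ d₂) σ∈P = bwd-⊞⁺ r₁ r₂ (Sum.map (sound d₁) (sound d₂) σ∈P)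
sound {r = r ⋆} (iter Q d) (k , σ∈Qk) =
  bwd-⋆⁺ r (k , ⊆-iterate-bwd r Q (λ j → sound (d j)) k σ∈Qk)

-- Each rule for a compound command derives the composed preimage, which `cons` replaces by
-- `bwd r Q` through the matching `⁻` inclusion.
⊢-bwd : ∀ (r : Reg n) Q → ⊢⟨ bwd r Q ⟩ r ⟨ Q ⟩
⊢-bwd (atom c)  Q = atom c Q
⊢-bwd (r₁ ⨾ r₂) Q = cons (bwd-⨾⁻ r₁ r₂) (seq (⊢-bwd r₁ (bwd r₂ Q)) (⊢-bwd r₂ Q)) id
⊢-bwd (r₁ ⊞ r₂) Q = cons (bwd-⊞⁻ r₁ r₂) (choice (⊢-bwd r₁ Q) (⊢-bwd r₂ Q)) id
⊢-bwd (r ⋆)     Q =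
  -- The induction hypothesis is used at every iterate as postcondition, since
  -- `iterate (bwd r) (suc k) Q` unfolds to `bwd r` of the `k`-th one.
  cons (bwd-⋆⁻ r) (iter (λ k → iterate (bwd r) k Q) (λ k → ⊢-bwd r (iterate (bwd r) k Q))) id

complete : ∀ {r : Reg n} {P Q} → ⊨⟨ P ⟩ r ⟨ Q ⟩ → ⊢⟨ P ⟩ r ⟨ Q ⟩
-- `bwd r Q` is the weakest valid precondition, so validity is itself the side condition of `cons`.
complete {r = r} {Q = Q} valid = cons valid (⊢-bwd r Q) id

mainTheorem3 : ∀ (n : ℕ) (r : Reg n) (P Q : StateSet n) →
    (⊢⟨ P ⟩ r ⟨ Q ⟩) ⇔ (⊨⟨ P ⟩ r ⟨ Q ⟩)
mainTheorem3 n r P Q =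
  mk⇔ {A = ⊢⟨ P ⟩ r ⟨ Q ⟩} {B = ⊨⟨ P ⟩ r ⟨ Q ⟩} (λ d → sound d) (λ valid → complete valid)
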